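{- Let $D$ be a skeletal directed acyclic graph. For any two join irreducibles $J$ and $J'$ of the acyclic reorientation lattice $\mathcal{AR}_D$, $J$ forces $J'$ if and only if the rope $\rho_\vee(J)$ is a subrope of the rope $\rho_\vee(J')$.
   Context: All directed graphs are finite and simple. A reorientation of a directed acyclic graph $D=(V,A)$ is a directed graph with the same underlying undirected graph, encoded by the set of arcs of $D$ that it reverses. $\mathcal{AR}_D$ is the poset of acyclic reorientations of $D$ ordered by inclusion of sets of reversed arcs. The transitive reduction of a directed acyclic graph is obtained by deleting all arcs whose endpoints are connected by a directed path of length at least $2$. A directed graph is a forest if its underlying undirected graph has no cycle. $D$ is vertebrate if the transitive reduction of every induced subgraph of $D$ is a forest; filled if for any directed path $\pi$ in $D$ whose endpoints are joined by an arc of $D$, all arcs joining any two vertices of $\pi$ belong to $D$; skeletal if vertebrate and filled. When $D$ is skeletal, $\mathcal{AR}_D$ is a congruence uniform lattice. A congruence of a lattice is an equivalence relation compatible with meets and joins; $\mathrm{con}(x,y)$ is the minimal (finest) congruence with $x\equiv y$. A join irreducible $J$ covers a unique element $J_\star$. $J$ forces $J'$ if $\mathrm{con}(J'_\star,J')$ refines $\mathrm{con}(J_\star,J)$, i.e. if every congruence $\equiv$ with $J_\star\equiv J$ also satisfies $J'_\star\equiv J'$. The transitive support of an arc $(u,v)$ of $D$ is the set of vertices appearing along directed paths in $D$ from $u$ to $v$. A rope of $D$ is a quadruple $(u,v,\nabla,\Delta)$ where $(u,v)\in A$ and $\nabla\sqcup\Delta$ is a partition of the transitive support of $(u,v)$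 minus $\{u,v\}$. A rope $(u,v,\nabla,\Delta)$ is a subrope of a rope $(u',v',\nabla',\Delta')$ if $\{u,v\}\subseteq\{u',v'\}\cup\nabla'\cup\Delta'$, $\nabla\subseteq\nabla'$ and $\Delta\subseteq\Delta'$. For a join irreducible $J$ of $\mathcal{AR}_D$, there is a unique arc $(u,v)$ of $D$ that is reversed in the transitive reduction of $J$, and $\rho_\vee(J)$ is the rope $(u,v,\nabla,\Delta)$ with $\nabla=\{w\in V : (u,w)\in D\setminus J,\ (w,v)\in D\cap J\}$ and $\Delta=\{w\in V : (u,w)\in D\cap J,\ (w,v)\in D\setminus J\}$ (membership refers to arcs). -}

module Defs where

open import Data.Bool.Base using (Bool; true; T)
open import Data.Bool.Properties using (T?)
open import Data.Fin.Base using (Fin)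
open import Data.Fin.Induction using (spo-wellFounded; spo-noetherian)
open import Data.Fin.Properties using (any?)
open import Data.Fin.Subset using (Subset; _∈_; _∪_; _∩_; _⊆_; ⁅_⁆; Empty)
open import Data.Fin.Subset.Properties using (x∈p∩q⁻; x∈p∪q⁻; x∈p∪q⁺)
open import Data.List.Base using (List; []; _∷_; _∷ʳ_; _++_; [_]; length)
open import Data.List.Properties using (++-assoc)
open import Data.List.Relation.Unary.All as All using ()
open import Data.List.Relation.Unary.All.Properties using (++⁻ʳ)
open import Data.List.Relation.Unary.AllPairs using (AllPairs; _∷_)
open import Data.List.Relation.Unary.Linked using (Linked; [-]; _∷_)
open import Data.List.Relation.Unary.Unique.Propositional using (Unique)
open import Data.Nat.Base as ℕ using (ℕ)
open import Data.Product.Base using (∃; ∃₂; _×_; _,_; proj₁; proj₂)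
open import Data.Sum.Base using (_⊎_; inj₁; inj₂)
open import Data.Vec.Base using (tabulate)
open import Data.Vec.Properties using (lookup⇒[]=; []=⇒lookup; lookup∘tabulate)
open import Function.Base using (flip; _∘_)
open import Function.Bundles using (_⇔_; mk⇔)
open import Induction.WellFounded using (Acc; acc)
open import Level using (0ℓ)
open import Relation.Binary.Bundles using (Poset)
open import Relation.Binary.Core using (Rel)
open import Relation.Binary.Definitions using (Decidable)
open import Relation.Binary.Structures using (IsEquivalence; IsStrictPartialOrder)
open import Relation.Binary.Construct.Closure.ReflexiveTransitive using (Star; ε; _◅_)
open import Relation.Binary.Construct.Closure.Symmetric using (SymClosure)
open import Relation.Binary.Construct.Closure.Transitive as Plus
  using (TransClosure; _∷_) renaming ([_] to [_]⁺)
open import Relation.Binary.Construct.Interior.Symmetric as Interior using (_,_)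
open import Relation.Binary.PropositionalEquality as ≡
  using (_≡_; _≢_; refl; sym; trans; subst; resp₂)
open import Relation.Nullary.Decidable
  using (Dec; yes; no; does; isYes; map′; _×-dec_; _⊎-dec_; ¬?; dec-true; toWitness; isYes≗does)
open import Relation.Nullary.Negation using (¬_; contradiction)
import Relation.Binary.Construct.NonStrictToStrict as ToStrict
import Relation.Unary as Unary

------------------------------------------------------------------------
-- Congruences and forcing

-- Binary joins and meets are relations here, so that congruences make
-- sense on a poset without choosing lattice operations.  In a lattice,
-- `Congruence` is the usual notion.

module Lattice (P : Poset 0ℓ 0ℓ 0ℓ) where
  open Poset P using (Carrier; _≈_; _≤_)
  open ToStrict _≈_ _≤_ using (_<_)

  IsJoin : Carrier → Carrier → Carrier → Set
  IsJoin x y z = x ≤ z × y ≤ z × (∀ w → x ≤ w → y ≤ w → z ≤ w)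

  IsMeet : Carrier → Carrier → Carrier → Set
  IsMeet x y z = z ≤ x × z ≤ y × (∀ w → w ≤ x → w ≤ y → w ≤ z)

  record Congruence : Set₁ where
    field
      _∼_           : Rel Carrier 0ℓ
      isEquivalence : IsEquivalence _∼_
      reflexive     : ∀ {x y} → x ≈ y → x ∼ y
      join-cong     : ∀ {x x′ y y′ z z′} → x ∼ x′ → y ∼ y′ →
                      IsJoin x y z → IsJoin x′ y′ z′ → z ∼ z′
      meet-cong     : ∀ {x x′ y y′ z z′} → x ∼ x′ → y ∼ y′ →
                      IsMeet x y z → IsMeet x′ y′ z′ → z ∼ z′

  _⋖_ : Rel Carrier 0ℓ
  x ⋖ y = x < y × (∀ z → ¬ (x < z × z < y))

  record JoinIrreducible : Set where
    field
      element : Carrier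
      lower   : Carrier
      covers  : lower ⋖ element
      unique  : ∀ {x} → x ⋖ element → x ≈ lower

  -- con(J′⋆ , J′) refines con(J⋆ , J), where con(x , y) is the finest
  -- congruence identifying x and y.
  Forces : Rel JoinIrreducible _
  Forces J J′ = (C : Congruence) → let open Congruence C in
    J.lower ∼ J.element → J′.lower ∼ J′.element
    where
    module J  = JoinIrreducible J
    module J′ = JoinIrreducible J′

------------------------------------------------------------------------
-- Directed graphs on Fin n

module _ {n : ℕ} where

  Acyclic : Rel (Fin n) 0ℓ → Set
  Acyclic R = ∀ {v} → ¬ TransClosure R v v

  TransitiveReduction : Rel (Fin n) 0ℓ → Rel (Fin n) 0ℓ
  TransitiveReduction R u v = R u v × ¬ (∃ λ w → R u w × TransClosure R w v)

  -- The vertices outside U are kept as isolated vertices, which affects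
  -- neither transitive reductions nor the existence of cycles.
  Induced : Rel (Fin n) 0ℓ → Subset n → Rel (Fin n) 0ℓ
  Induced R U u v = u ∈ U × v ∈ U × R u v

  -- The cycle x , x₁ , … , xₖ , x of length at least 3 in the underlying
  -- undirected graph, where xs = x₁ ∷ … ∷ xₖ ∷ [].
  record IsCycle (R : Rel (Fin n) 0ℓ) (x : Fin n) (xs : List (Fin n)) : Set where
    field
      long     : 2 ℕ.≤ length xs
      distinct : Unique (x ∷ xs)
      closed   : Linked (SymClosure R) (x ∷ xs ∷ʳ x)

  Forest : Rel (Fin n) 0ℓ → Set
  Forest R = ∀ x xs → ¬ IsCycle R x xs

-- Acyclicity excludes loops and pairs of opposite arcs, so these digraphs
-- are simple.
record DAG (n : ℕ) : Set where
  field
    arc : Fin n → Fin n → Bool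

  Arc : Rel (Fin n) 0ℓ
  Arc u v = T (arc u v)

  Arc? : Decidable Arc
  Arc? u v = T? (arc u v)

  field
    acyclic : Acyclic Arc

module _ {n : ℕ} (D : DAG n) where
  open DAG D

  Vertebrate : Set
  Vertebrate = ∀ U → Forest (TransitiveReduction (Induced Arc U))

  -- By acyclicity, an arc joining two vertices of a directed path is
  -- oriented along the path.
  Filled : Set
  Filled = ∀ u xs v → Linked Arc (u ∷ xs ∷ʳ v) → Arc u v → AllPairs Arc (u ∷ xs ∷ʳ v)

  Skeletal : Set
  Skeletal = Vertebrate × Filled

------------------------------------------------------------------------
-- Acyclic reorientations

  -- The arcs of the reorientation of D that reverses the arcs in S.
  Reoriented : Rel (Fin n) 0ℓ → Rel (Fin n) 0ℓ
  Reoriented S u v = (Arc u v × ¬ S u v) ⊎ S v u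

  record AcyclicReorientation : Set where
    field
      reversed : Fin n → Fin n → Bool

    Reversed : Rel (Fin n) 0ℓ
    Reversed u v = T (reversed u v)

    Oriented : Rel (Fin n) 0ℓ
    Oriented = Reoriented Reversed

    field
      reversed⇒arc : ∀ {u v} → Reversed u v → Arc u v
      acyclic      : Acyclic Oriented

    Reversed? : Decidable Reversed
    Reversed? u v = T? (reversed u v)

    Oriented? : Decidable Oriented
    Oriented? u v = (Arc? u v ×-dec ¬? (Reversed? u v)) ⊎-dec Reversed? v u

  open AcyclicReorientation

  -- Equality of reorientations is mutual inclusion of their sets of
  -- reversed arcs.
  AR : Poset 0ℓ 0ℓ 0ℓ
  AR = Interior.poset
    {R = λ E F → ∀ u v → Reversed E u v → Reversed F u v}
    (λ _ _ r → r) (λ E≤F F≤G u v r → F≤G u v (E≤F u v r))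

  open Lattice AR public using ()
    renaming (JoinIrreducible to ARJoinIrreducible; Forces to ARForces)

------------------------------------------------------------------------
-- Ropes

  TransitiveSupport : Fin n → Fin n → Unary.Pred (Fin n) 0ℓ
  TransitiveSupport u v w = Star Arc u w × Star Arc w v

  record Rope : Set where
    field
      u v      : Fin n
      isArc    : Arc u v
      ∇ Δ      : Subset n
      disjoint : Empty (∇ ∩ Δ)
      covering : ∀ w → w ∈ ∇ ∪ Δ ⇔ (TransitiveSupport u v w × w ≢ u × w ≢ v)

  Subrope : Rel Rope 0ℓ
  Subrope r r′ =
    (⁅ R.u ⁆ ∪ ⁅ R.v ⁆) ⊆ ((⁅ R′.u ⁆ ∪ ⁅ R′.v ⁆) ∪ (R′.∇ ∪ R′.Δ)) ×
    R.∇ ⊆ R′.∇ ×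
    R.Δ ⊆ R′.Δ
    where
    module R  = Rope r
    module R′ = Rope r′

------------------------------------------------------------------------
-- The rope of a join irreducible

  ReversedInReduction : AcyclicReorientation → Rel (Fin n) 0ℓ
  ReversedInReduction E u v = Reversed E u v × TransitiveReduction (Oriented E) v u

  -- A reorientation is identified with its set of arcs, so an arc of D
  -- that is not an arc of E is one that E reverses.
  In∇ InΔ : AcyclicReorientation → Fin n → Fin n → Unary.Pred (Fin n) 0ℓ
  In∇ E u v w = (Arc u w × ¬ Oriented E u w) × (Arc w v × Oriented E w v)
  InΔ E u v w = (Arc u w × Oriented E u w) × (Arc w v × ¬ Oriented E w v)

  In∇? : ∀ E u v → Unary.Decidable (In∇ E u v)
  In∇? E u v w = (Arc? u w ×-dec ¬? (Oriented? E u w)) ×-dec (Arc? w v ×-dec Oriented? E w v)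

  InΔ? : ∀ E u v → Unary.Decidable (InΔ E u v)
  InΔ? E u v w = (Arc? u w ×-dec Oriented? E u w) ×-dec (Arc? w v ×-dec ¬? (Oriented? E w v))

module _ {n : ℕ} {P : Unary.Pred (Fin n) 0ℓ} where

  comprehension : Unary.Decidable P → Subset n
  comprehension P? = tabulate (does ∘ P?)

  ∈-comprehension⁺ : ∀ (P? : Unary.Decidable P) {w} → P w → w ∈ comprehension P?
  ∈-comprehension⁺ P? {w} p =
    lookup⇒[]= w _ (trans (lookup∘tabulate (does ∘ P?) w) (dec-true (P? w) p))

  ∈-comprehension⁻ : ∀ (P? : Unary.Decidable P) {w} → w ∈ comprehension P? → P w
  ∈-comprehension⁻ P? {w} w∈ = toWitness {a? = P? w} (subst T (sym eq) _)
    where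
    eq : isYes (P? w) ≡ true
    eq = trans (isYes≗does (P? w))
           (trans (sym (lookup∘tabulate (does ∘ P?) w)) ([]=⇒lookup w∈))

-- The transitive closure of an acyclic decidable relation on Fin n is
-- decidable, by well-founded induction along the relation.
module Reachability {n : ℕ} {R : Rel (Fin n) 0ℓ}
                    (R? : Decidable R) (acyclic : Acyclic R) where

  isStrictPartialOrder : IsStrictPartialOrder _≡_ (TransClosure R)
  isStrictPartialOrder = record
    { isEquivalence = ≡.isEquivalence
    ; irrefl        = λ { refl → acyclic }
    ; trans         = Plus._++_
    ; <-resp-≈      = resp₂ _
    }

  reachable? : Decidable (TransClosure R)
  reachable? a = go (spo-noetherian isStrictPartialOrder a)
    where
    go : ∀ {a} → Acc (flip (TransClosure R)) a → ∀ b → Dec (TransClosure R a b)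
    go {a} (acc rs) b = map′
      (λ { (inj₁ r) → [ r ]⁺ ; (inj₂ (_ , r , p)) → r ∷ p })
      (λ { [ r ]⁺ → inj₁ r ; (r ∷ p) → inj₂ (_ , r , p) })
      (R? a b ⊎-dec any? step?)
      where
      step? : ∀ w → Dec (R a w × TransClosure R w b)
      step? w with R? a w
      ... | no ¬r = no (¬r ∘ proj₁)
      ... | yes r = map′ (r ,_) proj₂ (go (rs [ r ]⁺) b)

  -- Every path refines to a path of the transitive reduction.
  refine : ∀ {S : Rel (Fin n) 0ℓ} → (∀ {a b} → TransitiveReduction R a b → S a b) →
           ∀ {a b} → TransClosure R a b → TransClosure S a b
  refine {S} reduction⇒S {a} {b} =
    go (spo-noetherian isStrictPartialOrder a) (spo-wellFounded isStrictPartialOrder b)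
    where
    go : ∀ {a b} → Acc (flip (TransClosure R)) a → Acc (TransClosure R) b →
         TransClosure R a b → TransClosure S a b
    go {a} {b} α@(acc rsₐ) β@(acc rs_b) p
      with any? (λ w → R? a w ×-dec reachable? w b)
    ... | yes (w , r , q) = go α (rs_b q) [ r ]⁺ Plus.++ go (rsₐ [ r ]⁺) β q
    go α β [ r ]⁺  | no ¬long = [ reduction⇒S (r , ¬long) ]⁺
    go α β (r ∷ q) | no ¬long = contradiction (_ , r , q) ¬long

module _ {n : ℕ} (D : DAG n) where
  open DAG D
  open AcyclicReorientation using (Reversed; Reversed?; Oriented; Oriented?; reversed⇒arc)

  -- If no arc were reversed in the transitive reduction, the reversal of
  -- an arc (u , v) would refine to a path from v to u in D.
  reversedInReduction : (J : ARJoinIrreducible D) →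
    ∃₂ (ReversedInReduction D (Lattice.JoinIrreducible.element J))
  reversedInReduction J with any? (λ u → any? (λ v →
      Reversed? E u v ×-dec Oriented? E v u ×-dec
      ¬? (any? (λ w → Oriented? E v w ×-dec reachable? w u))))
    where
    E = Lattice.JoinIrreducible.element J
    open Reachability (Oriented? E) (AcyclicReorientation.acyclic E)
  ... | yes found = found
  ... | no ¬found = contradiction (lower≤E , λ u v r → contradiction r (notReversed u v)) lower≉E
    where
    open Lattice.JoinIrreducible J renaming (element to E)
    open Reachability (Oriented? E) (AcyclicReorientation.acyclic E)

    lower≤E = proj₁ (proj₁ covers)
    lower≉E = proj₂ (proj₁ covers)

    reduction⇒arc : ∀ {a b} → TransitiveReduction (Oriented E) a b → Arc a b
    reduction⇒arc (inj₁ (a , _) , _) = a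
    reduction⇒arc (inj₂ r , ¬long)   = contradiction (_ , _ , r , inj₂ r , ¬long) ¬found

    notReversed : ∀ u v → ¬ Reversed E u v
    notReversed u v r = acyclic (reversed⇒arc E r ∷ refine reduction⇒arc [ inj₂ r ]⁺)

  toPlus : ∀ {a b} → Star Arc a b → a ≢ b → TransClosure Arc a b
  toPlus ε        a≢a = contradiction refl a≢a
  toPlus (r ◅ rs) _   = go r rs
    where
    go : ∀ {a b c} → Arc a b → Star Arc b c → TransClosure Arc a c
    go r ε        = [ r ]⁺
    go r (s ◅ ss) = r ∷ go s ss

  linked : ∀ {a b zs} → TransClosure Arc a b → Linked Arc (b ∷ zs) →
           ∃ λ xs → Linked Arc (a ∷ xs ++ b ∷ zs)
  linked [ r ]⁺  l = [] , r ∷ l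
  linked (r ∷ p) l with xs , l′ ← linked p l = _ ∷ xs , r ∷ l′

  -- In a filled digraph, a vertex between the endpoints of an arc is
  -- joined to both endpoints.
  filled⇒arcs : Filled D → ∀ {u v w} → Arc u v →
                TransClosure Arc u w → TransClosure Arc w v → Arc u w × Arc w v
  filled⇒arcs filled {u} {v} {w} uv p q
    with ys , l  ← linked q [-]
    with xs , l′ ← linked p l
    = split xs (subst (λ zs → AllPairs Arc (u ∷ zs)) assoc
        (filled u (xs ++ w ∷ ys) v (subst (λ zs → Linked Arc (u ∷ zs)) (sym assoc) l′) uv))
    where
    assoc : (xs ++ w ∷ ys) ++ [ v ] ≡ xs ++ w ∷ ys ++ [ v ]
    assoc = ++-assoc xs (w ∷ ys) [ v ]

    after : ∀ xs → AllPairs Arc (xs ++ w ∷ ys ++ [ v ]) → Arc w v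
    after []       (all ∷ _) = All.head (++⁻ʳ ys all)
    after (_ ∷ xs) (_ ∷ ps)  = after xs ps

    split : ∀ xs → AllPairs Arc (u ∷ xs ++ w ∷ ys ++ [ v ]) → Arc u w × Arc w v
    split xs (all ∷ ps) = All.head (++⁻ʳ xs all) , after xs ps

  -- The arc found is the only arc of D reversed in the transitive
  -- reduction of J, since J is join irreducible.
  ρ∨ : Skeletal D → ARJoinIrreducible D → Rope D
  ρ∨ (_ , filled) J with reversedInReduction J
  ... | u , v , uv-rev , _ , ¬long = record
    { u        = u
    ; v        = v
    ; isArc    = uv
    ; ∇        = comprehension ∇?
    ; Δ        = comprehension Δ?
    ; disjoint = λ { (w , w∈) → let w∈∇ , w∈Δ = x∈p∩q⁻ _ _ w∈ in
                     proj₂ (proj₁ (∈-comprehension⁻ ∇? w∈∇))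
                       (proj₂ (proj₁ (∈-comprehension⁻ Δ? w∈Δ))) }
    ; covering = λ w → mk⇔ (supported w ∘ x∈p∪q⁻ _ _) (covered w)
    }
    where
    E  = Lattice.JoinIrreducible.element J
    ∇? = In∇? D E u v
    Δ? = InΔ? D E u v
    uv = reversed⇒arc E uv-rev

    between : ∀ {w} → Arc u w → Arc w v → TransitiveSupport D u v w × w ≢ u × w ≢ v
    between uw wv = (uw ◅ ε , wv ◅ ε) ,
      (λ { refl → acyclic [ uw ]⁺ }) , (λ { refl → acyclic [ wv ]⁺ })

    supported : ∀ w → w ∈ comprehension ∇? ⊎ w ∈ comprehension Δ? →
                TransitiveSupport D u v w × w ≢ u × w ≢ v
    supported w (inj₁ w∈) with (uw , _) , (wv , _) ← ∈-comprehension⁻ ∇? w∈ = between uw wv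
    supported w (inj₂ w∈) with (uw , _) , (wv , _) ← ∈-comprehension⁻ Δ? w∈ = between uw wv

    reverse : ∀ {a b} → Arc a b → ¬ Oriented E a b → Oriented E b a
    reverse {a} {b} ab ¬o with Reversed? E a b
    ... | yes r = inj₂ r
    ... | no ¬r = contradiction (inj₁ (ab , ¬r)) ¬o

    covered : ∀ w → TransitiveSupport D u v w × w ≢ u × w ≢ v →
              w ∈ comprehension ∇? ∪ comprehension Δ?
    covered w ((p , q) , w≢u , w≢v)
      with uw , wv ← filled⇒arcs filled uv (toPlus p (w≢u ∘ sym)) (toPlus q w≢v)
      with Oriented? E u w | Oriented? E w v
    ... | yes o | no ¬o = x∈p∪q⁺ (inj₂ (∈-comprehension⁺ Δ? ((uw , o) , wv , ¬o)))
    ... | no ¬o | yes o = x∈p∪q⁺ (inj₁ (∈-comprehension⁺ ∇? ((uw , ¬o) , wv , o)))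
    ... | yes o | yes o′ = contradiction (o ∷ o′ ∷ [ inj₂ uv-rev ]⁺)
                             (AcyclicReorientation.acyclic E)
    ... | no ¬o | no ¬o′ = contradiction (w , reverse wv ¬o′ , [ reverse uw ¬o ]⁺) ¬long

{-# OPTIONS --safe #-}

-- In a skeletal digraph the transitive support of an arc is totally
-- ordered, so a join irreducible consists of the arcs (x , y) crossing its
-- rope (u , v , ∇ , Δ): x ∈ {u} ∪ Δ and y ∈ {v} ∪ ∇.  If J forces J′, then
-- the Cambrian congruence given by the signs of the rope of J′, which does
-- not contract J′, does not contract J either; it contracts every join
-- irreducible whose rope is not a subrope of that of J′.  Conversely, from
-- a subrope one finds P with J⋆ ≤ P, J′ ≤ P ∨ J and P ∧ J′ ≤ J′⋆.

module Submission where

open import Defs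
open import Data.Fin.Base using (Fin)
open import Data.Fin.Induction using (spo-wellFounded; spo-noetherian)
open import Data.Fin.Properties using (any?; _≟_)
open import Data.Fin.Subset using (Subset; _∈_; _∉_; _∪_; ⁅_⁆)
open import Data.Fin.Subset.Properties
  using (_∈?_; _⊆?_; x∈p∪q⁺; x∈p∪q⁻; x∈p∩q⁺; x∈⁅x⁆; x∈⁅y⁆⇒x≡y)
open import Data.List.Base using ([]; _∷_)
open import Data.List.Relation.Unary.All using ([]; _∷_)
open import Data.List.Relation.Unary.AllPairs using ([]; _∷_)
open import Data.List.Relation.Unary.Linked using ([-]; _∷_)
open import Data.Nat.Base as ℕ using (ℕ; z≤n; s≤s)
open import Data.Nat.Properties as ℕ using ()
open import Data.Product.Base using (∃₂; _×_; _,_; proj₁; proj₂)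
open import Data.Sum.Base as Sum using (_⊎_; inj₁; inj₂)
open import Function.Base using (flip; id; _∘_)
open import Function.Bundles using (_⇔_; mk⇔; Equivalence)
open import Induction.WellFounded using (Acc; acc)
open import Level using (0ℓ)
open import Relation.Binary.Bundles using (Poset)
open import Relation.Binary.Core using (Rel; _⇒_)
open import Relation.Binary.Definitions using (Decidable)
open import Relation.Binary.Structures using (IsEquivalence)
open import Relation.Binary.Construct.Closure.ReflexiveTransitive using (Star; ε; _◅_; _◅◅_)
open import Relation.Binary.Construct.Closure.Symmetric using (fwd; bwd)
open import Relation.Binary.Construct.Closure.Transitive
  using (TransClosure; _∷_; _∷ʳ_) renaming ([_] to [_]⁺)
open import Relation.Binary.Construct.Interior.Symmetric using (SymInterior; _,_)
open import Relation.Binary.PropositionalEquality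
  using (_≡_; _≢_; refl; sym; trans; subst; subst₂)
open import Relation.Nullary.Decidable
  using (Dec; yes; no; ⌊_⌋; toWitness; fromWitness; decidable-stable; _×-dec_; _⊎-dec_; ¬?)
open import Relation.Nullary.Negation using (¬_; contradiction)
import Relation.Unary as Unary

-- Vertebrateness makes supports total: two incomparable vertices between the ends of an arc would
-- yield a 4-cycle in a transitive reduction. Filledness makes supports convex, which removes the
-- main obstacle: a set of arcs prescribed on one chain has to be acyclic in all of `D`, including
-- paths that leave the chain. The Cambrian relation compares the join irreducibles below two
-- elements, so it respects meets at once. Joins are the difficulty. They are reduced to meets by
-- complementing the set of reversed arcs, which reverses the order and exchanges the signs; that
-- the relation survives this exchange is the combinatorial core. Joins and meets being relations,
-- the argument for a subrope has to exhibit each one that it uses with its universal property.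

module _ {A : Set} {R S : Rel A 0ℓ} where

  mapPath : R ⇒ S → TransClosure R ⇒ TransClosure S
  mapPath f [ r ]⁺  = [ f r ]⁺
  mapPath f (r ∷ p) = f r ∷ mapPath f p

  reversePath : R ⇒ flip S → TransClosure R ⇒ flip (TransClosure S)
  reversePath f [ r ]⁺  = [ f r ]⁺
  reversePath f (r ∷ p) = reversePath f p ∷ʳ f r

pathToStar : ∀ {A : Set} {R : Rel A 0ℓ} → TransClosure R ⇒ Star R
pathToStar [ r ]⁺  = r ◅ ε
pathToStar (r ∷ p) = r ◅ pathToStar p

starCons : ∀ {A : Set} {R : Rel A 0ℓ} {x y z} → R x y → Star R y z → TransClosure R x z
starCons r ε       = [ r ]⁺
starCons r (s ◅ p) = r ∷ starCons s p

-- The members of L play the role of Δ, those of H the role of ∇.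
record Signs (n : ℕ) : Set₁ where
  field
    L H      : Unary.Pred (Fin n) 0ℓ
    L?       : Unary.Decidable L
    H?       : Unary.Decidable H
    signed   : ∀ x → L x ⊎ H x
    disjoint : ∀ {x} → L x → ¬ H x

opposite : ∀ {n} → Signs n → Signs n
opposite S = record
  { L = S.H ; H = S.L ; L? = S.H? ; H? = S.L?
  ; signed = Sum.swap ∘ S.signed ; disjoint = flip S.disjoint }
  where module S = Signs S

-- The sign `L` on the endpoints of the rope and off its chain is a default that never decides
-- whether an arc is a crossing. Signs are total so that coclosure can always place a middle vertex.
signsOf : ∀ {n} → Subset n → Signs n
signsOf ∇ = record
  { L = _∉ ∇ ; H = _∈ ∇ ; L? = ¬? ∘ (_∈? ∇) ; H? = _∈? ∇
  ; signed = sign ; disjoint = id }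
  where
  sign : ∀ x → x ∉ ∇ ⊎ x ∈ ∇
  sign x with x ∈? ∇
  ... | yes x∈ = inj₂ x∈
  ... | no  x∉ = inj₁ x∉

module _ {n : ℕ} (D : DAG n) where
  open DAG D
  open AcyclicReorientation using (Reversed; Reversed?; Oriented; reversed⇒arc)
  open Poset (AR D) using (_≤_; _≈_)

  -- Closed and coclosed sets of reversed arcs

  Path : Rel (Fin n) 0ℓ
  Path = TransClosure Arc

  no-loop : ∀ {x} → ¬ Arc x x
  no-loop a = acyclic [ a ]⁺

  no-2-cycle : ∀ {x y} → Arc x y → ¬ Arc y x
  no-2-cycle a b = acyclic (a ∷ [ b ]⁺)

  no-3-cycle : ∀ {x y z} → Arc x y → Arc y z → ¬ Arc z x
  no-3-cycle a b c = acyclic (a ∷ b ∷ [ c ]⁺)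

  closed : ∀ (E : AcyclicReorientation D) {x y z} →
           Arc x z → Reversed E x y → Reversed E y z → Reversed E x z
  closed E {x} {y} {z} xz r s with Reversed? E x z
  ... | yes t = t
  ... | no ¬t = contradiction (inj₁ (xz , ¬t) ∷ inj₂ s ∷ [ inj₂ r ]⁺)
                  (AcyclicReorientation.acyclic E)

  coclosed : ∀ (E : AcyclicReorientation D) {x y z} →
             Arc x y → Arc y z → Reversed E x z → Reversed E x y ⊎ Reversed E y z
  coclosed E {x} {y} {z} xy yz t with Reversed? E x y | Reversed? E y z
  ... | yes r | _     = inj₁ r
  ... | no _  | yes s = inj₂ s
  ... | no ¬r | no ¬s = contradiction (inj₁ (xy , ¬r) ∷ inj₁ (yz , ¬s) ∷ [ inj₂ t ]⁺)
                          (AcyclicReorientation.acyclic E)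

  module FromRelation {S : Rel (Fin n) 0ℓ} (S? : Decidable S) (S⇒Arc : S ⇒ Arc)
                      (S-acyclic : Acyclic (Reoriented D S)) where

    element : AcyclicReorientation D
    element = record
      { reversed     = λ x y → ⌊ S? x y ⌋
      ; reversed⇒arc = S⇒Arc ∘ toWitness
      ; acyclic      = S-acyclic ∘ mapPath
          (Sum.map (λ { (xy , ¬r) → xy , ¬r ∘ fromWitness }) toWitness)
      }

    sound : ∀ {x y} → Reversed element x y → S x y
    sound = toWitness

    complete : ∀ {x y} → S x y → Reversed element x y
    complete = fromWitness

  -- Complementation as an anti-automorphism

  module Complement (E : AcyclicReorientation D) where

    S : Rel (Fin n) 0ℓ
    S x y = Arc x y × ¬ Reversed E x y

    turn : Reoriented D S ⇒ flip (Oriented E)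
    turn {x} {y} (inj₁ (xy , ¬s)) = inj₂ (decidable-stable (Reversed? E x y) (¬s ∘ (xy ,_)))
    turn         (inj₂ s)         = inj₁ s

    open FromRelation {S} (λ x y → Arc? x y ×-dec ¬? (Reversed? E x y)) proj₁
      (AcyclicReorientation.acyclic E ∘ reversePath turn) public

  co : AcyclicReorientation D → AcyclicReorientation D
  co E = Complement.element E

  co-galois : ∀ {E F} → E ≤ co F → F ≤ co E
  co-galois {E} {F} E≤ x y r = Complement.complete E
    (reversed⇒arc F r , λ s → proj₂ (Complement.sound F (E≤ x y s)) r)

  co-antitone : ∀ {E F} → E ≤ F → co F ≤ co E
  co-antitone {E} {F} E≤F x y r = let xy , ¬s = Complement.sound F r in
    Complement.complete E (xy , ¬s ∘ E≤F x y)

  co-co-≤ : ∀ E → co (co E) ≤ E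
  co-co-≤ E x y r = let xy , ¬s = Complement.sound (co E) r in
    decidable-stable (Reversed? E x y) (λ ¬t → ¬s (Complement.complete E (xy , ¬t)))

  ≤-co-co : ∀ E → E ≤ co (co E)
  ≤-co-co E x y r = Complement.complete (co E)
    (reversed⇒arc E r , λ s → proj₂ (Complement.sound E s) r)

  -- Lower covers and join irreducibles

  module Unflip (E : AcyclicReorientation D) {u v} (uv-red : ReversedInReduction D E u v) where

    uv-rev : Reversed E u v
    uv-rev = proj₁ uv-red

    S : Rel (Fin n) 0ℓ
    S x y = Reversed E x y × ¬ (x ≡ u × y ≡ v)

    Kept : Rel (Fin n) 0ℓ
    Kept x y = Oriented E x y × ¬ (x ≡ v × y ≡ u)

    step : ∀ {x y} → Reoriented D S x y → Kept x y ⊎ (x ≡ u × y ≡ v)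
    step (inj₂ (r , ¬uv)) = inj₁ (inj₂ r , λ { (refl , refl) → ¬uv (refl , refl) })
    step {x} {y} (inj₁ (xy , ¬s)) with x ≟ u ×-dec y ≟ v
    ... | yes uv = inj₂ uv
    ... | no ¬uv = inj₁ (inj₁ (xy , λ r → ¬s (r , ¬uv)) ,
                         λ { (refl , refl) → no-2-cycle xy (reversed⇒arc E uv-rev) })

    -- A path using the restored arc keeps only its part before the first use and its part after the
    -- last one; around a cycle these compose to a path of `E` from `v` to `u`, which `no-return`
    -- excludes.
    path : ∀ {x y} → TransClosure (Reoriented D S) x y →
           TransClosure Kept x y ⊎ (Star Kept x u × Star Kept v y)
    path [ s ]⁺ with step s
    ... | inj₁ k             = inj₁ [ k ]⁺
    ... | inj₂ (refl , refl) = inj₂ (ε , ε)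
    path (s ∷ p) with step s | path p
    ... | inj₁ k             | inj₁ q        = inj₁ (k ∷ q)
    ... | inj₁ k             | inj₂ (q , q′) = inj₂ (k ◅ q , q′)
    ... | inj₂ (refl , refl) | inj₁ q        = inj₂ (ε , pathToStar q)
    ... | inj₂ (refl , refl) | inj₂ (_ , q′) = inj₂ (ε , q′)

    no-return : ¬ Star Kept v u
    no-return ε                  = no-loop (reversed⇒arc E uv-rev)
    no-return ((_ , ¬vu) ◅ ε)    = ¬vu (refl , refl)
    no-return ((o , _) ◅ k ◅ p)  = proj₂ (proj₂ uv-red) (_ , o , mapPath proj₁ (starCons k p))

    S-acyclic : Acyclic (Reoriented D S)
    S-acyclic p with path p
    ... | inj₁ q        = AcyclicReorientation.acyclic E (mapPath proj₁ q)
    ... | inj₂ (q , q′) = no-return (q′ ◅◅ q)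

    open FromRelation {S} (λ x y → Reversed? E x y ×-dec ¬? (x ≟ u ×-dec y ≟ v))
      (reversed⇒arc E ∘ proj₁) S-acyclic public

    open Lattice (AR D) using (_⋖_)

    covered : element ⋖ E
    covered = ((λ x y r → proj₁ (sound r)) ,
               λ el≈E → proj₂ (sound (SymInterior.rhs≤lhs el≈E u v uv-rev)) (refl , refl)) , tight
      where
      tight : ∀ F → ¬ ((element ≤ F × ¬ element ≈ F) × (F ≤ E × ¬ F ≈ E))
      tight F ((el≤F , el≉F) , (F≤E , F≉E)) with Reversed? F u v
      ... | yes r = F≉E (F≤E , E≤F)
        where
        E≤F : E ≤ F
        E≤F x y s with x ≟ u ×-dec y ≟ v
        ... | yes (refl , refl) = r
        ... | no ¬uv            = el≤F x y (complete (s , ¬uv))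
      ... | no ¬r = el≉F (el≤F , λ x y s → complete
                      (F≤E x y s , λ { (refl , refl) → ¬r s }))

  module IrreducibleProperties (J : ARJoinIrreducible D) {u v}
    (uv-red : ReversedInReduction D (Lattice.JoinIrreducible.element J) u v) where

    open Lattice.JoinIrreducible J using (lower; covers; unique) renaming (element to E)
    module E⋆ = Unflip E uv-red

    E⋆≈lower : E⋆.element ≈ lower
    E⋆≈lower = unique E⋆.covered

    ∉lower : ¬ Reversed lower u v
    ∉lower r = proj₂ (E⋆.sound (SymInterior.rhs≤lhs E⋆≈lower u v r)) (refl , refl)

    ∈lower : ∀ {x y} → Reversed E x y → ¬ (x ≡ u × y ≡ v) → Reversed lower x y
    ∈lower {x} {y} r ¬uv = SymInterior.lhs≤rhs E⋆≈lower x y (E⋆.complete (r , ¬uv))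

    -- Restoring another such arc would also give `lower`, which still reverses that arc.
    onlyReversed : ∀ {x y} → ReversedInReduction D E x y → x ≡ u × y ≡ v
    onlyReversed {x} {y} xy-red = decidable-stable (x ≟ u ×-dec y ≟ v) λ ¬uv →
      proj₂ (F.sound (SymInterior.rhs≤lhs (unique F.covered) x y (∈lower (proj₁ xy-red) ¬uv)))
        (refl , refl)
      where module F = Unflip E xy-red

    -- `F` agrees with `E` on the transitive reduction of `E`, whose only reversed arc is `(u , v)`.
    -- Every arc of `E` thus refines to a path of `F`, so orienting one differently closes a cycle.
    minimal : ∀ {F} → F ≤ E → Reversed F u v → E ≤ F
    minimal {F} F≤E uv-rev x y r = decidable-stable (Reversed? F x y) λ ¬s →
      AcyclicReorientation.acyclic F
        (inj₁ (reversed⇒arc E r , ¬s) ∷ refine reduction⇒F [ inj₂ r ]⁺)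
      where
      open Reachability (AcyclicReorientation.Oriented? E) (AcyclicReorientation.acyclic E)

      reduction⇒F : ∀ {a b} → TransitiveReduction (Oriented E) a b → Oriented F a b
      reduction⇒F {a} {b} (inj₁ (ab , ¬r) , _) = inj₁ (ab , ¬r ∘ F≤E a b)
      reduction⇒F (inj₂ r , ¬long)
        with refl , refl ← onlyReversed (r , inj₂ r , ¬long) = inj₂ uv-rev

  -- The support of an arc as a convex chain

  infix 4 _⊑_ _⊑?_

  -- Built from arcs, not paths: transitivity is available inside a chain, through
  -- `Chain.arc-trans`.
  _⊑_ : Rel (Fin n) 0ℓ
  x ⊑ y = x ≡ y ⊎ Arc x y

  _⊑?_ : Decidable _⊑_
  x ⊑? y = x ≟ y ⊎-dec Arc? x y

  -- For an arc `(a , b)` of a filled digraph, this is its transitive support with paths replaced by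
  -- arcs.
  InChain : Fin n → Fin n → Unary.Pred (Fin n) 0ℓ
  InChain a b x = a ⊑ x × x ⊑ b

  InChain? : ∀ a b → Unary.Decidable (InChain a b)
  InChain? a b x = a ⊑? x ×-dec x ⊑? b

  not-⊑ : ∀ {x y} → Arc x y → ¬ (y ⊑ x)
  not-⊑ xy (inj₁ refl) = no-loop xy
  not-⊑ xy (inj₂ yx)   = no-2-cycle xy yx

  ⊑-antisym : ∀ {x y} → x ⊑ y → y ⊑ x → x ≡ y
  ⊑-antisym (inj₁ x≡y) _  = x≡y
  ⊑-antisym (inj₂ xy)  yx = contradiction yx (not-⊑ xy)

  prependPath : ∀ {a x y} → a ⊑ x → Path x y → Path a y
  prependPath (inj₁ refl) p = p
  prependPath (inj₂ ax)   p = ax ∷ p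

  appendPath : ∀ {x y b} → Path x y → y ⊑ b → Path x b
  appendPath p (inj₁ refl) = p
  appendPath p (inj₂ yb)   = p ∷ʳ yb

  module _ (skeletal : Skeletal D) where

    private
      vertebrate = proj₁ skeletal
      filled     = proj₂ skeletal

    -- Otherwise p , x , q , y is a cycle in the transitive reduction of
    -- the subgraph induced by these four vertices.
    diamond : ∀ {p q x y} → Arc p x → Arc x q → Arc p y → Arc y q →
              x ≢ y → ¬ Arc x y → ¬ ¬ Arc y x
    diamond {p} {q} {x} {y} px xq py yq x≢y ¬xy ¬yx =
      vertebrate U p (x ∷ q ∷ y ∷ []) record
        { long     = s≤s (s≤s z≤n)
        ; distinct = (arc-≢ px ∷ (λ { refl → no-2-cycle px xq }) ∷ arc-≢ py ∷ [])
                   ∷ (arc-≢ xq ∷ x≢y ∷ [])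
                   ∷ ((arc-≢ yq ∘ sym) ∷ [])
                   ∷ [] ∷ []
        ; closed   = fwd (lower px xq ¬yx x∈ members)
                   ∷ fwd (upper px xq ¬xy x∈ members)
                   ∷ bwd (upper py yq ¬yx y∈ members′)
                   ∷ bwd (lower py yq ¬xy y∈ members′)
                   ∷ [-]
        }
      where
      U : Subset n
      U = (⁅ p ⁆ ∪ ⁅ q ⁆) ∪ (⁅ x ⁆ ∪ ⁅ y ⁆)

      p∈ : p ∈ U
      p∈ = x∈p∪q⁺ (inj₁ (x∈p∪q⁺ (inj₁ (x∈⁅x⁆ p))))

      q∈ : q ∈ U
      q∈ = x∈p∪q⁺ (inj₁ (x∈p∪q⁺ (inj₂ (x∈⁅x⁆ q))))

      x∈ : x ∈ U
      x∈ = x∈p∪q⁺ (inj₂ (x∈p∪q⁺ (inj₁ (x∈⁅x⁆ x))))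

      y∈ : y ∈ U
      y∈ = x∈p∪q⁺ (inj₂ (x∈p∪q⁺ (inj₂ (x∈⁅x⁆ y))))

      arc-≢ : ∀ {s t} → Arc s t → s ≢ t
      arc-≢ st refl = no-loop st

      OneOf : Fin n → Fin n → Fin n → Set
      OneOf z z′ w = (w ≡ p ⊎ w ≡ q) ⊎ (w ≡ z ⊎ w ≡ z′)

      members : ∀ {w} → w ∈ U → OneOf x y w
      members w∈ = Sum.map
        (Sum.map (x∈⁅y⁆⇒x≡y _) (x∈⁅y⁆⇒x≡y _) ∘ x∈p∪q⁻ _ _)
        (Sum.map (x∈⁅y⁆⇒x≡y _) (x∈⁅y⁆⇒x≡y _) ∘ x∈p∪q⁻ _ _) (x∈p∪q⁻ _ _ w∈)

      members′ : ∀ {w} → w ∈ U → OneOf y x w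
      members′ = Sum.map₂ Sum.swap ∘ members

      lower : ∀ {z z′} → Arc p z → Arc z q → ¬ Arc z′ z → z ∈ U →
              (∀ {w} → w ∈ U → OneOf z z′ w) → TransitiveReduction (Induced Arc U) p z
      lower {z} {z′} pz zq ¬z′z z∈ cases = (p∈ , z∈ , pz) , λ { (w , (_ , w∈ , pw) , π) →
        excluded pw (mapPath (proj₂ ∘ proj₂) π) (cases w∈) }
        where
        excluded : ∀ {w} → Arc p w → Path w z → ¬ OneOf z z′ w
        excluded pw π (inj₁ (inj₁ refl)) = no-loop pw
        excluded pw π (inj₁ (inj₂ refl)) = acyclic (zq ∷ π)
        excluded pw π (inj₂ (inj₁ refl)) = acyclic π
        -- The path from `z′` to `z` may be long while only an arc is forbidden; filledness provides
        -- the arc.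
        excluded pw π (inj₂ (inj₂ refl)) = ¬z′z (proj₂ (filled⇒arcs D filled pz [ pw ]⁺ π))

      upper : ∀ {z z′} → Arc p z → Arc z q → ¬ Arc z z′ → z ∈ U →
              (∀ {w} → w ∈ U → OneOf z z′ w) → TransitiveReduction (Induced Arc U) z q
      upper {z} {z′} pz zq ¬zz′ z∈ cases = (z∈ , q∈ , zq) , λ { (w , (_ , w∈ , zw) , π) →
        excluded zw (mapPath (proj₂ ∘ proj₂) π) (cases w∈) }
        where
        excluded : ∀ {w} → Arc z w → Path w q → ¬ OneOf z z′ w
        excluded zw π (inj₁ (inj₁ refl)) = no-2-cycle pz zw
        excluded zw π (inj₁ (inj₂ refl)) = acyclic π
        excluded zw π (inj₂ (inj₁ refl)) = no-loop zw
        excluded zw π (inj₂ (inj₂ refl)) = ¬zz′ zw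

    module Chain {a b : Fin n} (ab : Arc a b) where

      left : InChain a b a
      left = inj₁ refl , inj₂ ab

      right : InChain a b b
      right = inj₂ ab , inj₁ refl

      convex : ∀ {x y z} → InChain a b x → InChain a b y → Path x z → Path z y → InChain a b z
      convex (ax , _) (_ , yb) p q =
        let az , zb = filled⇒arcs D filled ab (prependPath ax p) (appendPath q yb)
        in inj₂ az , inj₂ zb

      total : ∀ {x y} → InChain a b x → InChain a b y → x ⊑ y ⊎ Arc y x
      total (inj₁ refl , _) (ay , _)         = inj₁ ay
      total (_ , inj₁ refl) (_ , inj₁ y≡b)   = inj₁ (inj₁ (sym y≡b))
      total (_ , inj₁ refl) (_ , inj₂ yb)    = inj₂ yb
      total (inj₂ ax , _)   (inj₁ refl , _)  = inj₂ ax
      total (_ , xb)        (_ , inj₁ refl)  = inj₁ xb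
      total {x} {y} (inj₂ ax , inj₂ xb) (inj₂ ay , inj₂ yb) with x ⊑? y | Arc? y x
      ... | yes xy | _      = inj₁ xy
      ... | no _   | yes yx = inj₂ yx
      ... | no ¬xy | no ¬yx = contradiction ¬yx
        (diamond ax xb ay yb (¬xy ∘ inj₁) (¬xy ∘ inj₂))

      arc-trans : ∀ {x y z} → InChain a b x → InChain a b z → Arc x y → Arc y z → Arc x z
      arc-trans cx cz xy yz with total cx cz
      ... | inj₁ (inj₁ refl) = contradiction yz (no-2-cycle xy)
      ... | inj₁ (inj₂ xz)   = xz
      ... | inj₂ zx          = contradiction zx (no-3-cycle xy yz)

      subchain : ∀ {x y w} → InChain a b x → InChain a b y → InChain x y w → InChain a b w
      subchain cx cy (inj₁ refl , _) = cx
      subchain cx cy (_ , inj₁ refl) = cy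
      subchain cx cy (inj₂ xw , inj₂ wy) = convex cx cy [ xw ]⁺ [ wy ]⁺

      -- Reorientations from biclosed sets on a chain

      -- A path leaving the chain cannot return to it by convexity, so a
      -- biclosed set of arcs of the chain is a reorientation.
      module Biclosed {R : Rel (Fin n) 0ℓ} (R? : Decidable R)
        (R-closed   : ∀ {x y z} → InChain a b y → Arc x y → Arc y z → R x y → R y z → R x z)
        (R-coclosed : ∀ {x y z} → InChain a b x → InChain a b y → InChain a b z →
                      Arc x y → Arc y z → R x z → R x y ⊎ R y z) where

        S O N : Rel (Fin n) 0ℓ
        S x y = InChain a b x × InChain a b y × Arc x y × R x y
        O     = Reoriented D S
        N x y = Arc x y × ¬ S x y

        S? : Decidable S
        S? x y = InChain? a b x ×-dec InChain? a b y ×-dec Arc? x y ×-dec R? x y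

        S-closed : ∀ {x y z} → Arc x z → S x y → S y z → S x z
        S-closed xz (cx , cy , xy , r) (_ , cz , yz , s) = cx , cz , xz , R-closed cy xy yz r s

        S-coclosed : ∀ {x y z} → InChain a b y → Arc x y → Arc y z → S x z → S x y ⊎ S y z
        S-coclosed cy xy yz (cx , cz , xz , r) =
          Sum.map (λ s → cx , cy , xy , s) (λ s → cy , cz , yz , s) (R-coclosed cx cy cz xy yz r)

        S⇒Arc : S ⇒ Arc
        S⇒Arc (_ , _ , xy , _) = xy

        O-asym : ∀ {x y} → O x y → ¬ O y x
        O-asym (inj₁ (xy , _))  (inj₁ (yx , _))  = no-2-cycle xy yx
        O-asym (inj₁ (_ , ¬s))  (inj₂ s)         = ¬s s
        O-asym (inj₂ s)         (inj₁ (_ , ¬s))  = ¬s s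
        O-asym (inj₂ s)         (inj₂ t)         = no-2-cycle (S⇒Arc s) (S⇒Arc t)

        -- The pair `x`, `z` is comparable, and orienting it against `x`, `y`, `z` would violate
        -- closure or coclosure on this triangle.
        O-trans : ∀ {x y z} → InChain a b x → InChain a b y → InChain a b z →
                  O x y → O y z → O x z
        O-trans {x} {y} {z} cx cy cz o o′ with total cx cz
        ... | inj₁ (inj₁ refl) = contradiction o′ (O-asym o)
        ... | inj₁ (inj₂ xz)   = inj₁ (xz , λ s → conflict s o o′)
          where
          conflict : S x z → O x y → ¬ O y z
          conflict s (inj₁ (xy , ¬t)) (inj₁ (yz , ¬t′)) = Sum.[ ¬t , ¬t′ ] (S-coclosed cy xy yz s)
          conflict s (inj₁ (xy , ¬t)) (inj₂ t′)         = ¬t (S-closed xy s t′)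
          conflict s (inj₂ t)         (inj₁ (yz , ¬t′)) = ¬t′ (S-closed yz t s)
          conflict s (inj₂ t)         (inj₂ t′)         = no-3-cycle xz (S⇒Arc t′) (S⇒Arc t)
        ... | inj₂ zx          = inj₂ (join o o′)
          where
          join : O x y → O y z → S z x
          join (inj₁ (xy , _))  (inj₁ (yz , _))   = contradiction zx (no-3-cycle xy yz)
          join (inj₁ (xy , ¬t)) (inj₂ t′)         =
            Sum.[ id , flip contradiction ¬t ] (S-coclosed cx zx xy t′)
          join (inj₂ t)         (inj₁ (yz , ¬t′)) =
            Sum.[ flip contradiction ¬t′ , id ] (S-coclosed cz yz zx t)
          join (inj₂ t)         (inj₂ t′)         = S-closed zx t′ t

        inside : ∀ {x y} → InChain a b x → InChain a b y → TransClosure N x y → O x y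
        inside cx cy [ m ]⁺  = inj₁ m
        inside cx cy (m ∷ p) = O-trans cx cz cy (inj₁ m) (inside cz cy p)
          where cz = convex cx cy [ proj₁ m ]⁺ (mapPath proj₁ p)

        -- A path which reverses some arc enters the chain at c and
        -- leaves it at d.
        Through : Rel (Fin n) 0ℓ
        Through x y = ∃₂ λ c d → Star N x c × InChain a b c × InChain a b d × O c d × Star N d y

        extend : ∀ {x y z} → InChain a b x → InChain a b y → InChain a b z →
                 O x y → Star N y z → O x z
        extend cx cy cz o ε       = o
        extend cx cy cz o (m ◅ p) = O-trans cx cy cz o (inside cy cz (starCons m p))

        through : ∀ {x y} → TransClosure O x y → TransClosure N x y ⊎ Through x y
        through [ inj₁ m ]⁺                 = inj₁ [ m ]⁺
        through [ inj₂ s@(cx , cy , _) ]⁺   = inj₂ (_ , _ , ε , cy , cx , inj₂ s , ε)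
        through (inj₁ m ∷ p) with through p
        ... | inj₁ q                             = inj₁ (m ∷ q)
        ... | inj₂ (c , d , q , rest)            = inj₂ (c , d , m ◅ q , rest)
        through (inj₂ s@(cz , cx , _) ∷ p) with through p
        ... | inj₁ q                             = inj₂ (_ , _ , ε , cx , cz , inj₂ s , pathToStar q)
        -- Two passes through the chain merge: the stretch of `N` between them has both ends in the
        -- chain, so `extend` absorbs it.
        ... | inj₂ (c , d , q , cc , cd , o , q′) = inj₂
          (_ , d , ε , cx , cd , O-trans cx cc cd (extend cx cz cc (inj₂ s) q) o , q′)

        O-acyclic : Acyclic O
        O-acyclic p with through p
        ... | inj₁ q                              = acyclic (mapPath proj₁ q)
        ... | inj₂ (c , d , q , cc , cd , o , q′) = O-asym loop loop
          where loop = extend cc cd cc o (q′ ◅◅ q)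

        open FromRelation S? S⇒Arc O-acyclic public

    -- Crossings of a signed chain

    Crossing : Signs n → Fin n → Fin n → Rel (Fin n) 0ℓ
    Crossing S a b x y =
      InChain a b x × InChain a b y × Arc x y × (x ≡ a ⊎ Signs.L S x) × (y ≡ b ⊎ Signs.H S y)

    self-crossing : ∀ S {a b} → Arc a b → Crossing S a b a b
    self-crossing S ab = Chain.left ab , Chain.right ab , ab , inj₁ refl , inj₁ refl

    module Crossings (S : Signs n) {a b : Fin n} (ab : Arc a b) where
      open Signs S

      cut? : Decidable (λ x y → (x ≡ a ⊎ L x) × (y ≡ b ⊎ H y))
      cut? x y = (x ≟ a ⊎-dec L? x) ×-dec (y ≟ b ⊎-dec H? y)

      cut-coclosed : ∀ {x y z} → (x ≡ a ⊎ L x) × (z ≡ b ⊎ H z) →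
        ((x ≡ a ⊎ L x) × (y ≡ b ⊎ H y)) ⊎ ((y ≡ a ⊎ L y) × (z ≡ b ⊎ H z))
      cut-coclosed {y = y} (l , h) with signed y
      ... | inj₁ Ly = inj₂ (inj₂ Ly , h)
      ... | inj₂ Hy = inj₁ (l , inj₂ Hy)

      cut-closed : ∀ {x y z} → (x ≡ a ⊎ L x) × (y ≡ b ⊎ H y) → (y ≡ a ⊎ L y) × (z ≡ b ⊎ H z) →
        (x ≡ a ⊎ L x) × (z ≡ b ⊎ H z)
      cut-closed (l , _) (_ , h) = l , h

      open Chain.Biclosed ab cut? (λ _ _ _ → cut-closed) (λ _ _ _ _ _ → cut-coclosed)
        using (element; sound; complete) public

    -- For an arc `(x , y)`: `E` lies above the join irreducible whose rope is `(x , y)` signed by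
    -- `S`. Phrased by arcs, it carries no proof that `(x , y)` is an arc.
    Contains : Signs n → AcyclicReorientation D → Rel (Fin n) 0ℓ
    Contains S E x y = Crossing S x y ⇒ Reversed E

    module _ (S : Signs n) where
      open Signs S

      contains : ∀ {E a b} (ab : Arc a b) → Crossings.element S ab ≤ E → Contains S E a b
      contains ab ≤E c = ≤E _ _ (Crossings.complete S ab c)

      contains⁻ : ∀ {E a b} (ab : Arc a b) → Contains S E a b → Crossings.element S ab ≤ E
      contains⁻ ab c⇒E x y = c⇒E ∘ Crossings.sound S ab

      -- Of the inversions of E crossing (x , y) with the opposite signs, a
      -- shortest one has all its own crossings in E.
      shortest : ∀ (E : AcyclicReorientation D) {a b} (ab : Arc a b) {x y} →
        Crossing (opposite S) a b x y → Reversed E x y →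
        ∃₂ λ x′ y′ → Crossing (opposite S) a b x′ y′ × Contains S E x′ y′
      shortest E {a} {b} ab {x₀} {y₀} =
        go (spo-noetherian isStrictPartialOrder x₀) (spo-wellFounded isStrictPartialOrder y₀)
        where
        open Reachability Arc? acyclic using (isStrictPartialOrder)

        go : ∀ {x y} → Acc (flip Path) x → Acc Path y →
             Crossing (opposite S) a b x y → Reversed E x y →
             ∃₂ λ x′ y′ → Crossing (opposite S) a b x′ y′ × Contains S E x′ y′
        go {x} {y} α@(acc αs) β@(acc βs) (cx , cy , xy , l , h) r
          with any? (λ w → Arc? x w ×-dec Arc? w y ×-dec H? w ×-dec Reversed? E w y)
             | any? (λ w → Arc? x w ×-dec Arc? w y ×-dec L? w ×-dec Reversed? E x w)
        -- As `w` has sign `H`, `(w , y)` is again a crossing for the opposite signs, and its left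
        -- end has moved up.
        ... | yes (w , xw , wy , Hw , s) | _ =
          go (αs [ xw ]⁺) β (Chain.convex ab cx cy [ xw ]⁺ [ wy ]⁺ , cy , wy , inj₂ Hw , h) s
        ... | no _ | yes (w , xw , wy , Lw , s) =
          go α (βs [ wy ]⁺) (cx , Chain.convex ab cx cy [ xw ]⁺ [ wy ]⁺ , xw , l , inj₂ Lw) s
        ... | no ¬H | no ¬L = x , y , (cx , cy , xy , l , h) , all
          where
          first : ∀ {q} → q ⊑ y → Arc x q → q ≡ y ⊎ H q → Reversed E x q
          first _           xq (inj₁ refl) = r
          first (inj₁ refl) xq (inj₂ _)    = r
          -- Coclosure splits the inversion `(x , y)` at `q`; the half `(q , y)` would be a shorter
          -- opposite crossing.
          first (inj₂ qy)   xq (inj₂ Hq)   with coclosed E xq qy r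
          ... | inj₁ s = s
          ... | inj₂ s = contradiction (_ , xq , qy , Hq , s) ¬H

          all : Contains S E x y
          all {p} {q} ((xp , py) , (xq , qy) , pq , lp , hq) = second xp py lp
            where
            second : x ⊑ p → p ⊑ y → p ≡ x ⊎ L p → Reversed E p q
            second _ _ (inj₁ refl) = first qy pq hq
            second (inj₁ refl) _ (inj₂ _) = first qy pq hq
            second (inj₂ xp) (inj₁ refl) (inj₂ Lp) =
              contradiction (appendPath [ pq ]⁺ qy) acyclic
            second (inj₂ xp) (inj₂ py) (inj₂ Lp) = Sum.[
              (λ s → contradiction (_ , xp , py , Lp , s) ¬L) , id ]
              (coclosed E xp pq (first qy xq′ hq))
              where xq′ = Chain.arc-trans xy (Chain.left xy) (xq , qy) xp pq

    -- Cambrian congruences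

    -- The Cambrian congruence of the signed chain: two reorientations are
    -- identified when they lie above the same join irreducibles whose rope
    -- inherits its signs from S.
    module Cambrian {a b : Fin n} (ab : Arc a b) where

      open Lattice (AR D) using (IsJoin; IsMeet; Congruence)

      Finer : Signs n → Rel (AcyclicReorientation D) 0ℓ
      Finer S E F = ∀ {x y} → InChain a b x → InChain a b y → Arc x y →
                    Contains S E x y → Contains S F x y

      -- If `E` reverses a crossing of an opposite rope contained in `co F`, then `shortest` gives a
      -- rope signed by `S` contained in `E`, hence in `F`. Its end arc is an opposite crossing too,
      -- so both `F` and `co F` reverse it.
      finer-co : ∀ S {E F} → Finer S E F → Finer (opposite S) (co F) (co E)
      finer-co S {E} {F} E≼F {x} {y} cx cy xy inF {p} {q} c@(_ , _ , pq , _) =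
        Complement.complete E (pq , λ r →
          let x′ , y′ , c′ , inE = shortest S E xy c r
              cx′ , cy′ , xy′ , _ = c′
              s = E≼F (Chain.subchain ab cx cy cx′) (Chain.subchain ab cx cy cy′) xy′ inE
                    (self-crossing S xy′)
          in proj₂ (Complement.sound F (inF c′)) s)

      finer-meet : ∀ S {x x′ y y′ z z′} → Finer S x x′ → Finer S y y′ →
                   IsMeet x y z → IsMeet x′ y′ z′ → Finer S z z′
      finer-meet S {x} {x′} {y} {y′} {z} {z′} x≼ y≼ (z≤x , z≤y , _) (_ , _ , glb) cp cq pq inz =
        contains S {z′} pq (glb (Crossings.element S pq)
          (contains⁻ S {x′} pq (x≼ cp cq pq (λ c → z≤x _ _ (inz c))))
          (contains⁻ S {y′} pq (y≼ cp cq pq (λ c → z≤y _ _ (inz c)))))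

      co-join : ∀ {x y z} → IsJoin x y z → IsMeet (co x) (co y) (co z)
      co-join {x} {y} {z} (x≤z , y≤z , lub) =
        co-antitone {x} {z} x≤z , co-antitone {y} {z} y≤z ,
        λ w w≤x w≤y → co-galois {z} {w}
          (lub (co w) (co-galois {w} {x} w≤x) (co-galois {w} {y} w≤y))

      -- This is `finer-meet` conjugated by `co`. Applying `opposite` twice restores `L` and `H` by
      -- computation, and crossings depend on nothing else.
      finer-join : ∀ S {x x′ y y′ z z′} → Finer S x x′ → Finer S y y′ →
                   IsJoin x y z → IsJoin x′ y′ z′ → Finer S z z′
      finer-join S {x} {x′} {y} {y′} {z} {z′} x≼ y≼ j j′ cp cq pq inz c =
        co-co-≤ z′ _ _ (finer-co (opposite S) {co z′} {co z}
          (finer-meet (opposite S) {co x′} {co x} {co y′} {co y} {co z′} {co z}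
            (finer-co S {x} {x′} x≼) (finer-co S {y} {y′} y≼)
            (co-join {x′} {y′} {z′} j′) (co-join {x} {y} {z} j))
          cp cq pq (λ d → ≤-co-co z _ _ (inz d)) c)

      congruence : Signs n → Congruence
      congruence S = record
        { _∼_ = λ E F → Finer S E F × Finer S F E
        ; isEquivalence = record
          { refl  = (λ _ _ _ → id) , (λ _ _ _ → id)
          ; sym   = λ { (f , g) → g , f }
          ; trans = λ { (f , g) (f′ , g′) →
              (λ cx cy xy i → f′ cx cy xy (f cx cy xy i)) ,
              (λ cx cy xy i → g cx cy xy (g′ cx cy xy i)) }
          }
        ; reflexive = λ { (E≤F , F≤E) →
              (λ _ _ _ i c → E≤F _ _ (i c)) , (λ _ _ _ i c → F≤E _ _ (i c)) }
        ; join-cong = λ { {x} {x′} {y} {y′} {z} {z′} (f , g) (f′ , g′) j j′ →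
              finer-join S {x} {x′} {y} {y′} {z} {z′} f f′ j j′ ,
              finer-join S {x′} {x} {y′} {y} {z′} {z} g g′ j′ j }
        ; meet-cong = λ { {x} {x′} {y} {y′} {z} {z′} (f , g) (f′ , g′) m m′ →
              finer-meet S {x} {x′} {y} {y′} {z} {z′} f f′ m m′ ,
              finer-meet S {x′} {x} {y′} {y} {z′} {z} g g′ m′ m }
        }

    -- Forcing from a subrope

    -- The signs are a parameter because `J` must also be described by the signs of the larger rope
    -- of `J′`.
    record IsCrossing (S : Signs n) (J : ARJoinIrreducible D) (u v : Fin n) : Set where
      open Lattice.JoinIrreducible J public using (lower) renaming (element to E)
      field
        isArc    : Arc u v
        sound    : Reversed E ⇒ Crossing S u v
        complete : Crossing S u v ⇒ Reversed E
        ∉lower   : ¬ Reversed lower u v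
        ∈lower   : ∀ {x y} → Reversed E x y → ¬ (x ≡ u × y ≡ v) → Reversed lower x y

      lower≤E : lower ≤ E
      lower≤E = proj₁ (proj₁ (Lattice.JoinIrreducible.covers J))

      lower⇒sound : ∀ {x y} → Reversed lower x y → Crossing S u v x y × ¬ (x ≡ u × y ≡ v)
      lower⇒sound r = sound (lower≤E _ _ r) , λ { (refl , refl) → ∉lower r }

    -- Write J and J′ for the join irreducibles of the ropes (u , v) and
    -- (a , b) signed by S.  P sorts the chain into blocks of ranks
    -- 0 , 1 , 2 , 3, each in decreasing order.  The block of rank 1 has
    -- maximum u and contains a, that of rank 2 has minimum v and contains
    -- b; Q merges these two blocks, which only requires reversing (u , v).
    -- Then P ∨ J⋆ = P and P ∨ J = Q ≥ J′, while P ∧ J′ ≤ J′⋆.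
    module Forcing (S : Signs n) {a b u v : Fin n} (ab : Arc a b)
      (cu : InChain a b u) (cv : InChain a b v) (uv : Arc u v) where

      open Signs S
      open Chain ab
      open Lattice (AR D) using (Congruence; IsJoin; IsMeet)

      Low High : Unary.Pred (Fin n) 0ℓ
      Low x  = x ⊑ u × (x ≡ u ⊎ x ≡ a ⊎ L x)
      High y = v ⊑ y × (y ≡ v ⊎ y ≡ b ⊎ H y)

      data Block (x : Fin n) : Set where
        rest-H : ¬ Low x → ¬ High x → H x → Block x
        low    : Low x → Block x
        high   : ¬ Low x → High x → Block x
        rest-L : ¬ Low x → ¬ High x → L x → Block x

      block : ∀ x → Block x
      block x with x ⊑? u ×-dec (x ≟ u ⊎-dec x ≟ a ⊎-dec L? x)
                 | v ⊑? x ×-dec (x ≟ v ⊎-dec x ≟ b ⊎-dec H? x) | signed x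
      ... | yes l | _     | _      = low l
      ... | no ¬l | yes h | _      = high ¬l h
      ... | no ¬l | no ¬h | inj₁ l = rest-L ¬l ¬h l
      ... | no ¬l | no ¬h | inj₂ h = rest-H ¬l ¬h h

      -- The parameter is the rank of the block `high`.
      rankOf : ℕ → ∀ {x} → Block x → ℕ
      rankOf k (rest-H _ _ _) = 0
      rankOf k (low _)        = 1
      rankOf k (high _ _)     = k
      rankOf k (rest-L _ _ _) = 3

      rank : ℕ → Fin n → ℕ
      rank k x = rankOf k (block x)

      low-not-high : ∀ {x} → Low x → ¬ High x
      low-not-high (xu , _) (vx , _) = acyclic (appendPath (appendPath [ uv ]⁺ vx) xu)

      rank-low : ∀ k {x} → Low x → rank k x ≡ 1
      rank-low k {x} l with block x
      ... | low _        = refl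
      ... | high ¬l _    = contradiction l ¬l
      ... | rest-H ¬l _ _ = contradiction l ¬l
      ... | rest-L ¬l _ _ = contradiction l ¬l

      rank-high : ∀ k {x} → High x → rank k x ≡ k
      rank-high k {x} h with block x
      ... | low l         = contradiction h (low-not-high l)
      ... | high _ _      = refl
      ... | rest-H _ ¬h _ = contradiction h ¬h
      ... | rest-L _ ¬h _ = contradiction h ¬h

      low-a : Low a
      low-a = proj₁ cu , inj₂ (inj₁ refl)

      low-u : Low u
      low-u = inj₁ refl , inj₁ refl

      high-b : High b
      high-b = proj₂ cv , inj₂ (inj₁ refl)

      high-v : High v
      high-v = inj₁ refl , inj₁ refl

      rank-source : ∀ k {x} → 1 ℕ.≤ k → x ≡ a ⊎ L x → 1 ℕ.≤ rank k x
      rank-source k 1≤k (inj₁ refl) = ℕ.≤-reflexive (sym (rank-low k low-a))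
      rank-source k {x} 1≤k (inj₂ Lx) with block x
      ... | rest-H _ _ Hx = contradiction Hx (disjoint Lx)
      ... | low _         = s≤s z≤n
      ... | high _ _      = 1≤k
      ... | rest-L _ _ _  = s≤s z≤n

      rank-target : ∀ k {y} → 1 ℕ.≤ k → y ≡ b ⊎ H y → rank k y ℕ.≤ k
      rank-target k 1≤k (inj₁ refl) = ℕ.≤-reflexive (rank-high k high-b)
      rank-target k {y} 1≤k (inj₂ Hy) with block y
      ... | rest-H _ _ _  = z≤n
      ... | low _         = 1≤k
      ... | high _ _      = ℕ.≤-refl
      ... | rest-L _ _ Ly = contradiction Hy (disjoint Ly)

      -- The bound is 1 and not 0 because `u` is low whatever its sign; dually, `rank-L` has 2 and
      -- not 3 because of `v`.
      rank-H : ∀ {x} → H x → ¬ High x → rank 2 x ℕ.≤ 1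
      rank-H {x} Hx ¬h with block x
      ... | rest-H _ _ _  = z≤n
      ... | low _         = s≤s z≤n
      ... | high _ h      = contradiction h ¬h
      ... | rest-L _ _ Lx = contradiction Hx (disjoint Lx)

      rank-L : ∀ {x} → L x → ¬ Low x → 2 ℕ.≤ rank 2 x
      rank-L {x} Lx ¬l with block x
      ... | rest-H _ _ Hx = contradiction Hx (disjoint Lx)
      ... | low l         = contradiction l ¬l
      ... | high _ _      = s≤s (s≤s z≤n)
      ... | rest-L _ _ _  = s≤s (s≤s z≤n)

      -- Arcs from `low` to `high` are all that `Q` reverses beyond `P`.
      unmerge : ∀ {x y} (β : Block x) (γ : Block y) → rankOf 1 γ ℕ.≤ rankOf 1 β →
                rankOf 2 γ ℕ.≤ rankOf 2 β ⊎ (Low x × High y)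
      unmerge _              (rest-H _ _ _) _  = inj₁ z≤n
      unmerge (rest-L _ _ _) (low _)        _  = inj₁ (s≤s z≤n)
      unmerge (rest-L _ _ _) (high _ _)     _  = inj₁ (s≤s (s≤s z≤n))
      unmerge (rest-L _ _ _) (rest-L _ _ _) _  = inj₁ ℕ.≤-refl
      unmerge (high _ _)     (low _)        _  = inj₁ (s≤s z≤n)
      unmerge (high _ _)     (high _ _)     _  = inj₁ ℕ.≤-refl
      unmerge (high _ _)     (rest-L _ _ _) (s≤s ())
      unmerge (low _)        (low _)        _  = inj₁ ℕ.≤-refl
      unmerge (low l)        (high _ h)     _  = inj₂ (l , h)
      unmerge (low _)        (rest-L _ _ _) (s≤s ())
      unmerge (rest-H _ _ _) (low _)        ()
      unmerge (rest-H _ _ _) (high _ _)     ()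
      unmerge (rest-H _ _ _) (rest-L _ _ _) ()

      merge : ∀ {x y} (β : Block x) (γ : Block y) → rankOf 2 γ ℕ.≤ rankOf 2 β →
              rankOf 1 γ ℕ.≤ rankOf 1 β
      merge _              (rest-H _ _ _) _  = z≤n
      merge (rest-L _ _ _) (low _)        _  = s≤s z≤n
      merge (rest-L _ _ _) (high _ _)     _  = s≤s z≤n
      merge (rest-L _ _ _) (rest-L _ _ _) _  = ℕ.≤-refl
      merge (high _ _)     (low _)        _  = ℕ.≤-refl
      merge (high _ _)     (high _ _)     _  = ℕ.≤-refl
      merge (high _ _)     (rest-L _ _ _) (s≤s (s≤s ()))
      merge (low _)        (low _)        _  = ℕ.≤-refl
      merge (low _)        (high _ _)     _  = ℕ.≤-refl
      merge (low _)        (rest-L _ _ _) (s≤s ())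
      merge (rest-H _ _ _) (low _)        ()
      merge (rest-H _ _ _) (high _ _)     ()
      merge (rest-H _ _ _) (rest-L _ _ _) ()

      Decreasing : ℕ → Rel (Fin n) 0ℓ
      Decreasing k x y = rank k y ℕ.≤ rank k x

      decreasing-coclosed : ∀ k {x y z} → InChain a b x → InChain a b y → InChain a b z →
        Arc x y → Arc y z → Decreasing k x z → Decreasing k x y ⊎ Decreasing k y z
      decreasing-coclosed k {x} {y} {z} _ _ _ _ _ zx with ℕ.≤-total (rank k y) (rank k x)
      ... | inj₁ yx = inj₁ yx
      ... | inj₂ xy = inj₂ (ℕ.≤-trans zx xy)

      module Blocks (k : ℕ) = Biclosed {Decreasing k} (λ x y → rank k y ℕ.≤? rank k x)
        (λ _ _ _ r s → ℕ.≤-trans s r)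
        (decreasing-coclosed k)
      module P = Blocks 2
      module Q = Blocks 1

      Cut : Rel (Fin n) 0ℓ
      Cut x y = ((x ≡ a ⊎ L x) × (y ≡ b ⊎ H y)) × Decreasing 2 x y

      cut-closed : ∀ {x y z} → InChain a b y → Arc x y → Arc y z → Cut x y → Cut y z → Cut x z
      cut-closed _ _ _ ((l , _) , r) ((_ , h) , s) = (l , h) , ℕ.≤-trans s r

      -- An intersection of two reversal sets is closed but rarely coclosed. This one is, so the
      -- meet of `P` and `J′` is their plain intersection.
      cut-coclosed : ∀ {x y z} → InChain a b x → InChain a b y → InChain a b z →
                     Arc x y → Arc y z → Cut x z → Cut x y ⊎ Cut y z
      cut-coclosed {x} {y} {z} cx cy cz xy yz ((l , h) , d) = split (signed y)
        where
        vz : v ⊑ y → Arc v z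
        vz (inj₁ refl) = yz
        vz (inj₂ vy)   = arc-trans cv cz vy yz

        xu : y ⊑ u → Arc x u
        xu (inj₁ refl) = xy
        xu (inj₂ yu)   = arc-trans cx cu xy yu

        lower : H y → Dec (v ⊑ y) → Decreasing 2 x y
        lower Hy (no ¬vy) = ℕ.≤-trans (rank-H Hy (¬vy ∘ proj₁)) (rank-source 2 (s≤s z≤n) l)
        -- Here `z` comes after `v` and so is high: `d` forces rank at least 2 on `x`, the most that
        -- `y` can have.
        lower Hy (yes vy) = ℕ.≤-trans (rank-target 2 (s≤s z≤n) (inj₂ Hy))
          (subst (ℕ._≤ rank 2 x) (rank-high 2 (inj₂ (vz vy) , inj₂ h)) d)

        upper : L y → Dec (y ⊑ u) → Decreasing 2 y z
        upper Ly (no ¬yu) = ℕ.≤-trans (rank-target 2 (s≤s z≤n) h) (rank-L Ly (¬yu ∘ proj₁))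
        upper Ly (yes yu) = ℕ.≤-trans
          (subst (rank 2 z ℕ.≤_) (rank-low 2 (inj₂ (xu yu) , inj₂ l)) d)
          (rank-source 2 (s≤s z≤n) (inj₂ Ly))

        split : L y ⊎ H y → Cut x y ⊎ Cut y z
        split (inj₁ Ly) = inj₂ ((inj₂ Ly , h) , upper Ly (y ⊑? u))
        split (inj₂ Hy) = inj₁ ((l , inj₂ Hy) , lower Hy (v ⊑? y))

      module M = Biclosed {Cut}
        (λ x y → Crossings.cut? S ab x y ×-dec (rank 2 y ℕ.≤? rank 2 x))
        cut-closed cut-coclosed

      module _ {J J′ : ARJoinIrreducible D}
               (isJ : IsCrossing S J u v) (isJ′ : IsCrossing S J′ a b) where

        private
          module J  = IsCrossing isJ
          module J′ = IsCrossing isJ′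

        P≤Q : P.element ≤ Q.element
        P≤Q x y r with cx , cy , xy , d ← P.sound r =
          Q.complete (cx , cy , xy , merge (block x) (block y) d)

        lower≤P : J.lower ≤ P.element
        lower≤P x y r with ((ux , xv) , (uy , yv) , xy , l , h) , ¬uv ← J.lower⇒sound r =
          P.complete (subchain cu cv (ux , xv) , subchain cu cv (uy , yv) , xy ,
                      decreasing ux yv l h)
          where
          -- A target of sign `H` before `v` is not high, so its rank is at most that of `u`; a
          -- source of sign `L` after `u` is not low, so its rank is at least 2.
          decreasing : u ⊑ x → y ⊑ v → x ≡ u ⊎ L x → y ≡ v ⊎ H y → Decreasing 2 x y
          decreasing (inj₁ refl) (inj₁ refl) _ _ = contradiction (refl , refl) ¬uv
          decreasing (inj₁ refl) (inj₂ yv) _ (inj₁ refl) = contradiction yv no-loop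
          decreasing (inj₁ refl) (inj₂ yv) _ (inj₂ Hy) =
            subst (rank 2 y ℕ.≤_) (sym (rank-low 2 low-u)) (rank-H Hy (not-⊑ yv ∘ proj₁))
          decreasing (inj₂ ux) _ (inj₁ refl) _ = contradiction ux no-loop
          decreasing (inj₂ ux) _ (inj₂ Lx) h = ℕ.≤-trans (target h) (rank-L Lx (not-⊑ ux ∘ proj₁))
            where
            target : y ≡ v ⊎ H y → rank 2 y ℕ.≤ 2
            target (inj₁ refl) = ℕ.≤-reflexive (rank-high 2 high-v)
            target (inj₂ Hy)   = rank-target 2 (s≤s z≤n) (inj₂ Hy)

        J≤Q : J.E ≤ Q.element
        J≤Q x y r with x ≟ u ×-dec y ≟ v
        ... | yes (refl , refl) = Q.complete (cu , cv , uv ,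
                ℕ.≤-reflexive (trans (rank-high 1 high-v) (sym (rank-low 1 low-u))))
        ... | no ¬uv            = P≤Q x y (lower≤P x y (J.∈lower r ¬uv))

        J′≤Q : J′.E ≤ Q.element
        J′≤Q x y r with cx , cy , xy , l , h ← J′.sound r = Q.complete (cx , cy , xy ,
          ℕ.≤-trans (rank-target 1 ℕ.≤-refl h) (rank-source 1 ℕ.≤-refl l))

        -- For `x` low and `y` high, `P` reverses `(x , u)` and `(v , y)` when these are arcs, and
        -- `J` reverses `(u , v)`; closure of `F` composes them.
        Q-least : ∀ F → P.element ≤ F → J.E ≤ F → Q.element ≤ F
        Q-least F P≤F J≤F x y r with cx , cy , xy , d ← Q.sound r
          with unmerge (block x) (block y) d
        ... | inj₁ d′      = P≤F x y (P.complete (cx , cy , xy , d′))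
        ... | inj₂ (l , h) = upto-y (proj₁ h) (upto-v (proj₁ l))
          where
          upto-v : x ⊑ u → Arc x v × Reversed F x v
          upto-v (inj₁ refl) = uv , J≤F u v (J.complete (self-crossing S uv))
          upto-v (inj₂ xu)   = xv , closed F xv
            (P≤F x u (P.complete (cx , cu , xu ,
              ℕ.≤-reflexive (trans (rank-low 2 low-u) (sym (rank-low 2 l))))))
            (J≤F u v (J.complete (self-crossing S uv)))
            where xv = arc-trans cx cv xu uv

          upto-y : v ⊑ y → Arc x v × Reversed F x v → Reversed F x y
          upto-y (inj₁ refl) (_  , s) = s
          upto-y (inj₂ vy)   (xv , s) = closed F xy s
            (P≤F v y (P.complete (cv , cy , vy ,
              ℕ.≤-reflexive (trans (rank-high 2 h) (sym (rank-high 2 high-v))))))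

        M≤P : M.element ≤ P.element
        M≤P x y r with cx , cy , xy , _ , d ← M.sound r = P.complete (cx , cy , xy , d)

        M≤J′ : M.element ≤ J′.E
        M≤J′ x y r with cx , cy , xy , lh , _ ← M.sound r = J′.complete (cx , cy , xy , lh)

        M≤lower : M.element ≤ J′.lower
        M≤lower x y r = J′.∈lower (M≤J′ x y r) λ { (refl , refl) → not-ab (M.sound r) }
          where
          not-ab : ¬ M.S a b
          not-ab (_ , _ , _ , _ , d) with subst₂ ℕ._≤_ (rank-high 2 high-b) (rank-low 2 low-a) d
          ... | s≤s ()

        M-greatest : ∀ F → F ≤ P.element → F ≤ J′.E → F ≤ M.element
        M-greatest F F≤P F≤J′ x y r
          with _ , _ , _ , d ← P.sound (F≤P x y r) | cx , cy , xy , lh ← J′.sound (F≤J′ x y r) =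
          M.complete (cx , cy , xy , lh , d)

        -- Joining `P` to `J.lower ∼ J.E` gives `P ∼ Q`; meeting with `J′` gives `M ∼ J′`; joining
        -- `J′.lower`, which lies above `M`, gives the claim.
        forcing : ARForces D J J′
        forcing C J⋆∼J = J′⋆∼J′
          where
          open Congruence C

          joinˡ : ∀ E F → F ≤ E → IsJoin E F E
          joinˡ E F F≤E = (λ _ _ → id) , F≤E , λ _ E≤w _ → E≤w

          joinʳ : ∀ E F → E ≤ F → IsJoin E F F
          joinʳ E F E≤F = E≤F , (λ _ _ → id) , λ _ _ F≤w → F≤w

          ∼-refl : ∀ E → E ∼ E
          ∼-refl E = IsEquivalence.refl isEquivalence

          P∼Q : P.element ∼ Q.element
          P∼Q = join-cong (∼-refl P.element) J⋆∼J
                  (joinˡ P.element J.lower lower≤P) (P≤Q , J≤Q , Q-least)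

          M∼J′ : M.element ∼ J′.E
          M∼J′ = meet-cong P∼Q (∼-refl J′.E) (M≤P , M≤J′ , M-greatest)
                   (J′≤Q , (λ _ _ → id) , λ _ _ w≤J′ → w≤J′)

          J′⋆∼J′ : J′.lower ∼ J′.E
          J′⋆∼J′ = join-cong (∼-refl J′.lower) M∼J′
                     (joinˡ J′.lower M.element M≤lower) (joinʳ J′.lower J′.E J′.lower≤E)

    -- Join irreducibles recovered from their ropes

    module RopeProperties (r : Rope D) where
      open Rope r

      support⇒chain : ∀ {w} → w ∈ ∇ ∪ Δ → InChain u v w
      support⇒chain {w} w∈ =
        let (p , q) , w≢u , w≢v = Equivalence.to (covering w) w∈
            uw , wv = filled⇒arcs D filled isArc (toPlus D p (w≢u ∘ sym)) (toPlus D q w≢v)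
        in inj₂ uw , inj₂ wv

      between⇒support : ∀ {w} → Arc u w → Arc w v → w ∈ ∇ ∪ Δ
      between⇒support {w} uw wv = Equivalence.from (covering w)
        ((uw ◅ ε , wv ◅ ε) , (λ { refl → no-loop uw }) , (λ { refl → no-loop wv }))

      between⇒Δ : ∀ {w} → Arc u w → Arc w v → w ∉ ∇ → w ∈ Δ
      between⇒Δ uw wv w∉ with x∈p∪q⁻ _ _ (between⇒support uw wv)
      ... | inj₁ w∈∇ = contradiction w∈∇ w∉
      ... | inj₂ w∈Δ = w∈Δ

      ends : Subset n
      ends = ⁅ u ⁆ ∪ ⁅ v ⁆

      member⇒chain : ∀ {w} → w ∈ ends ∪ (∇ ∪ Δ) → InChain u v w
      member⇒chain w∈ with x∈p∪q⁻ ends _ w∈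
      ... | inj₂ w∈∇Δ = support⇒chain w∈∇Δ
      ... | inj₁ w∈ends with x∈p∪q⁻ ⁅ u ⁆ _ w∈ends
      ...   | inj₁ w∈u with refl ← x∈⁅y⁆⇒x≡y _ w∈u = Chain.left isArc
      ...   | inj₂ w∈v with refl ← x∈⁅y⁆⇒x≡y _ w∈v = Chain.right isArc

      chain⇒member : ∀ {w} → InChain u v w → w ∈ ends ∪ (∇ ∪ Δ)
      chain⇒member (inj₁ refl , _)      = x∈p∪q⁺ (inj₁ (x∈p∪q⁺ (inj₁ (x∈⁅x⁆ _))))
      chain⇒member (_ , inj₁ refl)      = x∈p∪q⁺ (inj₁ (x∈p∪q⁺ (inj₂ (x∈⁅x⁆ _))))
      chain⇒member (inj₂ uw , inj₂ wv)  = x∈p∪q⁺ (inj₂ (between⇒support uw wv))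

      not-both : ∀ {w} → w ∈ ∇ → w ∉ Δ
      not-both w∈∇ w∈Δ = disjoint (_ , x∈p∩q⁺ (w∈∇ , w∈Δ))

    -- Isolates what is used of `ρ∨`, so that its case split on the search for the reversed arc is
    -- unfolded only once.
    record IsRopeOf (J : ARJoinIrreducible D) (r : Rope D) : Set where
      open Rope r
      open Lattice.JoinIrreducible J renaming (element to E)
      field
        reduced : ReversedInReduction D E u v
        ∈∇      : ∀ {w} → w ∈ ∇ → In∇ D E u v w
        ∈Δ      : ∀ {w} → w ∈ Δ → InΔ D E u v w

    ρ∨-isRopeOf : ∀ J → IsRopeOf J (ρ∨ D skeletal J)
    ρ∨-isRopeOf J with reversedInReduction D J
    ... | u , v , red = record
      { reduced = red
      ; ∈∇      = ∈-comprehension⁻ (In∇? D E u v)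
      ; ∈Δ      = ∈-comprehension⁻ (InΔ? D E u v)
      }
      where E = Lattice.JoinIrreducible.element J

    module _ {J : ARJoinIrreducible D} {r : Rope D} (isRopeOf : IsRopeOf J r) where

      open Rope r
      open RopeProperties r
      open Lattice.JoinIrreducible J renaming (element to E)
      open IrreducibleProperties J (IsRopeOf.reduced isRopeOf)

      private
        module I = IsRopeOf isRopeOf

      ¬oriented⇒reversed : ∀ {x y} → Arc x y → ¬ Oriented E x y → Reversed E x y
      ¬oriented⇒reversed {x} {y} xy ¬o =
        decidable-stable (Reversed? E x y) (λ ¬s → ¬o (inj₁ (xy , ¬s)))

      oriented⇒¬reversed : ∀ {x y} → Arc x y → Oriented E x y → ¬ Reversed E x y
      oriented⇒¬reversed xy (inj₁ (_ , ¬s)) = ¬s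
      oriented⇒¬reversed xy (inj₂ s) _      = no-2-cycle xy (reversed⇒arc E s)

      ∇-left : ∀ {w} → w ∈ ∇ → Reversed E u w
      ∇-left w∈ with (uw , ¬o) , _ ← I.∈∇ w∈ = ¬oriented⇒reversed uw ¬o

      ∇-right : ∀ {w} → w ∈ ∇ → ¬ Reversed E w v
      ∇-right w∈ with _ , (wv , o) ← I.∈∇ w∈ = oriented⇒¬reversed wv o

      Δ-left : ∀ {w} → w ∈ Δ → ¬ Reversed E u w
      Δ-left w∈ with (uw , o) , _ ← I.∈Δ w∈ = oriented⇒¬reversed uw o

      -- Arcs from `u` to `∇` or `v` are reversed, while `(u , x)` is not for `x` in `Δ`; coclosure
      -- along `u`, `x`, `y` then reverses `(x , y)`.
      crossing⇒reversed : Crossing (signsOf ∇) u v ⇒ Reversed E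
      crossing⇒reversed {x} {y} ((ux , xv) , (_ , yv) , xy , l , h) = from-source ux xv l
        where
        from-u : y ≡ v ⊎ y ∈ ∇ → Reversed E u y
        from-u (inj₁ refl) = proj₁ I.reduced
        from-u (inj₂ y∈)   = ∇-left y∈

        from-source : u ⊑ x → x ⊑ v → x ≡ u ⊎ x ∉ ∇ → Reversed E x y
        from-source _ _ (inj₁ refl)                   = from-u h
        from-source (inj₁ refl) _ (inj₂ _)            = from-u h
        from-source (inj₂ _) (inj₁ refl) (inj₂ _)     = contradiction yv (not-⊑ xy)
        from-source (inj₂ ux) (inj₂ xv) (inj₂ x∉)     = Sum.[
          flip contradiction (Δ-left (between⇒Δ ux xv x∉)) , id ] (coclosed E ux xy (from-u h))

      -- Soundness is minimality of `E`: the crossings form a reorientation below `E` that reverses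
      -- `(u , v)`.
      isCrossing : IsCrossing (signsOf ∇) J u v
      isCrossing = record
        { isArc    = isArc
        ; sound    = λ s → Crossings.sound S isArc (minimal {Crossings.element S isArc}
                       (λ x y c → crossing⇒reversed (Crossings.sound S isArc c))
                       (Crossings.complete S isArc (self-crossing S isArc)) _ _ s)
        ; complete = crossing⇒reversed
        ; ∉lower   = ∉lower
        ; ∈lower   = ∈lower
        }
        where S = signsOf ∇

    -- Forcing compared with subropes

    module _ {J J′ : ARJoinIrreducible D} {r r′ : Rope D}
             (isRope : IsRopeOf J r) (isRope′ : IsRopeOf J′ r′) where

      private
        module R  = Rope r
        module R′ = Rope r′
        module P  = RopeProperties r
        module P′ = RopeProperties r′
        S  = signsOf R.∇
        S′ = signsOf R′.∇
        module J  = IsCrossing (isCrossing isRope)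
        module J′ = IsCrossing (isCrossing isRope′)

      subrope⇒forces : Subrope D r r′ → ARForces D J J′
      subrope⇒forces (ends⊆ , ∇⊆ , Δ⊆) =
        Forcing.forcing S′ R′.isArc (P′.member⇒chain (ends⊆ (x∈p∪q⁺ (inj₁ (x∈⁅x⁆ _)))))
          (P′.member⇒chain (ends⊆ (x∈p∪q⁺ (inj₂ (x∈⁅x⁆ _))))) R.isArc
          isCrossing′ (isCrossing isRope′)
        where
        crossing⇒ : Crossing S R.u R.v ⇒ Crossing S′ R.u R.v
        crossing⇒ {x} (cx@(ux , xv) , cy , xy , l , h) =
          cx , cy , xy , source ux xv l , Sum.map₂ ∇⊆ h
          where
          source : R.u ⊑ x → x ⊑ R.v → x ≡ R.u ⊎ x ∉ R.∇ → x ≡ R.u ⊎ x ∉ R′.∇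
          source _ _ (inj₁ x≡u)                      = inj₁ x≡u
          source (inj₁ refl) _ (inj₂ _)              = inj₁ refl
          source (inj₂ _) (inj₁ refl) (inj₂ _)       = contradiction (proj₂ cy) (not-⊑ xy)
          source (inj₂ ux) (inj₂ xv) (inj₂ x∉)       =
            inj₂ λ x∈ → P′.not-both x∈ (Δ⊆ (P.between⇒Δ ux xv x∉))

        crossing⇐ : Crossing S′ R.u R.v ⇒ Crossing S R.u R.v
        crossing⇐ {y = y} (cx , cy@(uy , yv) , xy , l , h) =
          cx , cy , xy , Sum.map₂ (_∘ ∇⊆) l , target uy yv h
          where
          target : R.u ⊑ y → y ⊑ R.v → y ≡ R.v ⊎ y ∈ R′.∇ → y ≡ R.v ⊎ y ∈ R.∇
          target _ _ (inj₁ y≡v)                 = inj₁ y≡v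
          target (inj₁ refl) _ (inj₂ _)         = contradiction (proj₁ cx) (not-⊑ xy)
          target (inj₂ _) (inj₁ refl) (inj₂ _)  = inj₁ refl
          target (inj₂ uy) (inj₂ yv) (inj₂ y∈)  = inj₂ (decidable-stable (y ∈? R.∇)
            λ y∉ → P′.not-both y∈ (Δ⊆ (P.between⇒Δ uy yv y∉)))

        -- The two sign vectors agree strictly between `R.u` and `R.v`, and crossings exempt the
        -- endpoints, where they may differ.
        isCrossing′ : IsCrossing S′ J R.u R.v
        isCrossing′ = record
          { isArc    = R.isArc
          ; sound    = crossing⇒ ∘ J.sound
          ; complete = J.complete ∘ crossing⇐
          ; ∉lower   = J.∉lower
          ; ∈lower   = J.∈lower
          }

      forces⇒subrope : ARForces D J J′ → Subrope D r r′
      forces⇒subrope forces = decidable-stable subrope? λ ¬sub →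
        J′.∉lower (proj₂ (forces (Cambrian.congruence R′.isArc S′) (contracted ¬sub))
          (Chain.left R′.isArc) (Chain.right R′.isArc) R′.isArc J′.complete
          (self-crossing S′ R′.isArc))
        where
        subrope? : Dec (Subrope D r r′)
        subrope? = _ ⊆? _ ×-dec R.∇ ⊆? R′.∇ ×-dec R.Δ ⊆? R′.Δ

        -- An interior vertex signed differently by the two ropes would make `(w , v)` or `(u , w)`
        -- a crossing for `S′`, hence reversed, although the definition of the rope of `J` leaves it
        -- unreversed.
        subrope : InChain R′.u R′.v R.u → InChain R′.u R′.v R.v →
                  Contains S′ J.E R.u R.v → Subrope D r r′
        subrope cu cv inJ = ends⊆ , ∇⊆ , Δ⊆
          where
          ends⊆ : ∀ {w} → w ∈ P.ends → w ∈ P′.ends ∪ (R′.∇ ∪ R′.Δ)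
          ends⊆ w∈ with x∈p∪q⁻ ⁅ R.u ⁆ _ w∈
          ... | inj₁ w∈u with refl ← x∈⁅y⁆⇒x≡y _ w∈u = P′.chain⇒member cu
          ... | inj₂ w∈v with refl ← x∈⁅y⁆⇒x≡y _ w∈v = P′.chain⇒member cv

          ∇⊆ : ∀ {w} → w ∈ R.∇ → w ∈ R′.∇
          ∇⊆ {w} w∈ with (uw , _) , (wv , _) ← IsRopeOf.∈∇ isRope w∈ =
            decidable-stable (w ∈? R′.∇) λ w∉ → ∇-right isRope w∈
              (inJ ((inj₂ uw , inj₂ wv) , Chain.right R.isArc , wv , inj₂ w∉ , inj₁ refl))

          Δ⊆ : ∀ {w} → w ∈ R.Δ → w ∈ R′.Δ
          Δ⊆ {w} w∈ with (uw , _) , (wv , _) ← IsRopeOf.∈Δ isRope w∈ =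
            inner (Chain.convex R′.isArc cu cv [ uw ]⁺ [ wv ]⁺)
            where
            w∉ : w ∉ R′.∇
            w∉ w∈′ = Δ-left isRope w∈
              (inJ (Chain.left R.isArc , (inj₂ uw , inj₂ wv) , uw , inj₁ refl , inj₂ w∈′))

            inner : InChain R′.u R′.v w → w ∈ R′.Δ
            inner (inj₁ refl , _)          = contradiction (proj₁ cu) (not-⊑ uw)
            inner (_ , inj₁ refl)          = contradiction (proj₂ cv) (not-⊑ wv)
            inner (inj₂ u′w , inj₂ wv′)    = P′.between⇒Δ u′w wv′ w∉

        contracted : ¬ Subrope D r r′ →
          let open Lattice.Congruence (Cambrian.congruence R′.isArc S′) in J.lower ∼ J.E
        contracted ¬sub = (λ _ _ _ inlower c → J.lower≤E _ _ (inlower c)) , finer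
          where
          finer : Cambrian.Finer R′.isArc S′ J.E J.lower
          finer cx cy xy inJ {p} {q} c with p ≟ R.u ×-dec q ≟ R.v
          ... | no ¬uv = J.∈lower (inJ c) ¬uv
          ... | yes (refl , refl)
            -- The arc `(x , y)` is reversed by `J`, so it lies within the chain of `(u , v)`;
            -- crossing it, `(u , v)` lies within the chain of `(x , y)`. The two arcs coincide.
            with (ux , _) , (_ , yv) , _ ← J.sound (inJ (self-crossing S′ xy))
               | (xu , _) , (_ , vy) , _ ← c
            with refl ← ⊑-antisym ux xu | refl ← ⊑-antisym yv vy =
            contradiction (subrope cx cy inJ) ¬sub

proposition37 : ∀ {n : ℕ} (D : DAG n) (skeletal : Skeletal D) (J J′ : ARJoinIrreducible D) → ARForces D J J′ ⇔ Subrope D (ρ∨ D skeletal J) (ρ∨ D skeletal J′)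
proposition37 D skeletal J J′ =
  mk⇔ (forces⇒subrope D skeletal isRope isRope′) (subrope⇒forces D skeletal isRope isRope′)
  where
  isRope  = ρ∨-isRopeOf D skeletal J
  isRope′ = ρ∨-isRopeOf D skeletal J′
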